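{- There exist three partition matroids $M_1,M_2,M_3$ on a common finite ground set $E$ such that, writing $I_k$ for the number of subsets of $E$ of size $k$ that are independent in all three of $M_1,M_2,M_3$, the sequence $I_0,I_1,\ldots,I_{|E|}$ is not log-concave.
   Context: A partition matroid on a finite set $E$ is given by a partition of $E$ into parts; its independent sets are the subsets of $E$ containing at most one element of each part. A sequence $a_0,a_1,\ldots,a_n$ is log-concave if it is non-negative, has no internal zeroes (the indices of its non-zero elements form an interval of integers), and satisfies $a_{i-1}a_{i+1}\leq a_i^2$ for every $1\leq i\leq n-1$. -}

module Defs where

open import Data.Empty using (⊥)
open import Data.Fin using (Fin)
open import Data.Fin.Subset using (Subset; inside; outside; _∈_; _∩_; ∣_∣; Nonempty; Empty)
open import Data.List using (List; []; _∷_; _++_; map; filter; length)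
open import Data.List.Membership.Propositional using () renaming (_∈_ to _∈ˡ_)
open import Data.List.Membership.Propositional.Properties using (∈-++⁺ˡ; ∈-++⁺ʳ; ∈-map⁺; ∈-map⁻)
open import Data.List.Relation.Unary.All as All using (All; all?)
open import Data.List.Relation.Unary.Any using (Any; here)
open import Data.List.Relation.Unary.AllPairs using (AllPairs; []; _∷_)
open import Data.List.Relation.Unary.Unique.Propositional using (Unique)
import Data.List.Relation.Unary.Unique.Propositional.Properties as Unique
open import Data.Nat using (ℕ; zero; suc; _+_; _*_; _∸_; _^_; _≤_; _<_; _≤?_; _≟_)
open import Data.Product using (∃; _×_; _,_)
open import Data.Vec using ([]; _∷_)
open import Data.Vec.Properties using (∷-injectiveʳ)
open import Relation.Binary.PropositionalEquality using (_≡_; _≢_; refl)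
open import Relation.Nullary using (Dec; _×-dec_)

record Partition (n : ℕ) : Set where
  field
    parts    : List (Subset n)
    nonempty : All Nonempty parts
    disjoint : AllPairs (λ P Q → Empty (P ∩ Q)) parts
    covering : ∀ (x : Fin n) → Any (x ∈_) parts

-- A partition matroid on the ground set Fin n is determined by its partition.
record PartitionMatroid (n : ℕ) : Set where
  field
    partition : Partition n

  open Partition partition public

  Independent : Subset n → Set
  Independent S = All (λ P → ∣ S ∩ P ∣ ≤ 1) parts

  independent? : ∀ S → Dec (Independent S)
  independent? S = all? (λ P → ∣ S ∩ P ∣ ≤? 1) parts

open PartitionMatroid using (Independent; independent?) public

subsets : ∀ n → List (Subset n)
subsets zero    = [] ∷ []
subsets (suc n) = map (outside ∷_) (subsets n) ++ map (inside ∷_) (subsets n)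

-- subsets n lists every subset exactly once, so filtering it and taking the
-- length counts subsets.
subsets-complete : ∀ {n} (S : Subset n) → S ∈ˡ subsets n
subsets-complete []            = here refl
subsets-complete (outside ∷ S) = ∈-++⁺ˡ (∈-map⁺ (outside ∷_) (subsets-complete S))
subsets-complete (inside ∷ S)  = ∈-++⁺ʳ _ (∈-map⁺ (inside ∷_) (subsets-complete S))

subsets-unique : ∀ n → Unique (subsets n)
subsets-unique zero    = All.[] ∷ []
subsets-unique (suc n) =
  Unique.++⁺ (Unique.map⁺ ∷-injectiveʳ (subsets-unique n))
             (Unique.map⁺ ∷-injectiveʳ (subsets-unique n))
             λ (p , q) → clash (∈-map⁻ (outside ∷_) p) (∈-map⁻ (inside ∷_) q)
  where
  clash : ∀ {S} → ∃ (λ T → T ∈ˡ subsets n × S ≡ outside ∷ T)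
                → ∃ (λ T → T ∈ˡ subsets n × S ≡ inside ∷ T) → ⊥
  clash (_ , _ , refl) (_ , _ , ())

CommonIndependent : ∀ {n} (M₁ M₂ M₃ : PartitionMatroid n) → Subset n → Set
CommonIndependent M₁ M₂ M₃ S = Independent M₁ S × Independent M₂ S × Independent M₃ S

commonIndependent? : ∀ {n} (M₁ M₂ M₃ : PartitionMatroid n) (S : Subset n) →
                     Dec (CommonIndependent M₁ M₂ M₃ S)
commonIndependent? M₁ M₂ M₃ S =
  independent? M₁ S ×-dec independent? M₂ S ×-dec independent? M₃ S

I : ∀ {n} (M₁ M₂ M₃ : PartitionMatroid n) → ℕ → ℕ
I {n} M₁ M₂ M₃ k =
  length (filter (λ S → (∣ S ∣ ≟ k) ×-dec commonIndependent? M₁ M₂ M₃ S) (subsets n))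

-- Log-concavity of the finite sequence a 0 , … , a n; values of a beyond n are
-- irrelevant.  Non-negativity is automatic for ℕ-valued sequences.
record LogConcave (n : ℕ) (a : ℕ → ℕ) : Set where
  field
    noInternalZeros : ∀ i j k → i < j → j < k → k ≤ n → a i ≢ 0 → a k ≢ 0 → a j ≢ 0
    logConcave      : ∀ i → 1 ≤ i → i ≤ n ∸ 1 → a (i ∸ 1) * a (i + 1) ≤ a i ^ 2

-- Seven elements that are parallel in all three matroids, together with three
-- further elements, each lying in the part of the seven in exactly one matroid:
-- a common independent set is one of the seven alone or any subset of the three.
-- Hence Σ I_k x^k = 7x + (1 + x)³ = 1 + 10x + 3x² + x³, and 10 · 1 > 3².
{-# OPTIONS --safe #-}
module Submission where

open import Defs
import Data.Fin.Properties as Fin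
open import Data.Fin.Subset using (Subset; inside; _∩_; ⁅_⁆)
open import Data.Fin.Subset.Properties using (_∈?_; nonempty?)
open import Data.Fin.Patterns using (0F; 1F; 2F; 7F; 8F; 9F)
open import Data.List using (List; []; _∷_)
open import Data.List.Relation.Unary.All using (all?)
open import Data.List.Relation.Unary.AllPairs using (allPairs?)
open import Data.List.Relation.Unary.Any using (any?)
open import Data.Nat using (ℕ; _≤?_; s≤s; z≤n)
open import Data.Product using (Σ-syntax; _,_)
open import Data.Vec using (_++_; replicate)
open import Relation.Nullary using (¬_; ¬?)
open import Relation.Nullary.Decidable using (True; toWitness; toWitnessFalse)

-- The partition axioms are decidable, so for concrete `parts` the implicit arguments are solved by
-- evaluation.
partitionMatroid : ∀ {n} (parts : List (Subset n))
  {_ : True (all? nonempty? parts)}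
  {_ : True (allPairs? (λ P Q → ¬? (nonempty? (P ∩ Q))) parts)}
  {_ : True (Fin.all? (λ x → any? (x ∈?_) parts))} →
  PartitionMatroid n
partitionMatroid parts {nonempty} {disjoint} {covering} = record
  { partition = record
    { parts    = parts
    ; nonempty = toWitness nonempty
    ; disjoint = toWitness disjoint
    ; covering = toWitness covering
    }
  }

-- Positions in `S` shift by seven: `0F`, `1F`, `2F` become the further elements `7F`, `8F`, `9F`.
sevenAnd : Subset 3 → Subset 10
sevenAnd S = replicate 7 inside ++ S

N₁ N₂ N₃ : PartitionMatroid 10
N₁ = partitionMatroid (sevenAnd ⁅ 0F ⁆ ∷ ⁅ 8F ⁆ ∷ ⁅ 9F ⁆ ∷ [])
N₂ = partitionMatroid (sevenAnd ⁅ 1F ⁆ ∷ ⁅ 7F ⁆ ∷ ⁅ 9F ⁆ ∷ [])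
N₃ = partitionMatroid (sevenAnd ⁅ 2F ⁆ ∷ ⁅ 7F ⁆ ∷ ⁅ 8F ⁆ ∷ [])

mainTheorem6 : Σ[ n ∈ ℕ ] Σ[ M₁ ∈ PartitionMatroid n ] Σ[ M₂ ∈ PartitionMatroid n ] Σ[ M₃ ∈ PartitionMatroid n ]
    ¬ LogConcave n (I M₁ M₂ M₃)
mainTheorem6 = 10 , N₁ , N₂ , N₃ , λ lc →
  -- At index 2 log-concavity asserts `I₁ * I₃ ≤ I₂ ^ 2`; counting over all 1024 subsets normalises
  -- this to `10 ≤ 9`.
  toWitnessFalse {a? = 10 ≤? 9} _ (LogConcave.logConcave lc 2 (s≤s z≤n) (s≤s (s≤s z≤n)))
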